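{- $$A^*=PAP^{ -1},\qquad A^{\varepsilon}=PA^*P^{ -1},\qquad A=PA^{\varepsilon}P^{ -1}.$$
   Context: Let $D$ be a positive integer and let $Q_D$ be the $D$-cube: the graph with vertex set $X=\{0,1\}^D$, two vertices being adjacent iff they differ in exactly one coordinate; $\partial$ denotes path-length distance. $\mathrm{Mat}_X(\mathbb{C})$ is the algebra of complex matrices with rows and columns indexed by $X$. Write $\mathbf{i}^2=-1$. Let $A$ be the adjacency matrix of $Q_D$. Fix $x=(0,0,\ldots,0)\in X$. Let $A^*$ be the diagonal matrix in $\mathrm{Mat}_X(\mathbb{C})$ with $(y,y)$-entry $D-2\partial(x,y)$ for $y\in X$ (the dual adjacency matrix). Let $A^{\varepsilon}=-\mathbf{i}(AA^*-A^*A)/2$ (the imaginary adjacency matrix). Let $P_1$ be the matrix with rows and columns indexed by $\{0,1\}$, with $(0,0)$-entry $1$, $(0,1)$-entry $1$, $(1,0)$-entry $-\mathbf{i}$, and $(1,1)$-entry $\mathbf{i}$. Let $P=P_1^{\otimes D}\in\mathrm{Mat}_X(\mathbb{C})$ be the $D$-fold Kronecker power, i.e. for $y=(y_1,\ldots,y_D)$ and $z=(z_1,\ldots,z_D)$ in $X$, $P_{yz}=\prod_{k=1}^D (P_1)_{y_kz_k}$. The matrix $P$ is invertible. -}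

module Defs where

open import Algebra.Bundles using (CommutativeRing; AbelianGroup; CommutativeMonoid)
open import Algebra.Definitions using (Congruent₂)
import Algebra.Construct.DirectProduct as DirectProduct
import Algebra.Definitions.RawMonoid as RawMonoidDefs
import Algebra.Properties.Ring as RingProperties
import Algebra.Solver.Ring.NaturalCoefficients.Default as SemiringSolver
open import Data.Empty using (⊥-elim)
open import Data.Fin.Base using (Fin; zero; suc)
import Data.Fin.Properties as Fin
open import Data.Nat.Base as ℕ using (ℕ; zero; suc)
import Data.Nat.Properties as ℕ
open import Data.Product using (_×_; _,_; proj₁; proj₂; ∃; ∃-syntax; ∃!; map₂)
open import Data.Rational.Base as ℚ using (ℚ; 0ℚ; 1ℚ; ½)
import Data.Rational.Properties as ℚ
import Data.Rational.Solver as ℚ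
open import Data.Vec.Base using (Vec; []; _∷_; lookup; replicate)
import Data.Vec.Properties as Vec
open import Level using (0ℓ)
open import Relation.Binary.Core using (Rel)
open import Relation.Binary.PropositionalEquality as ≡ using (_≡_; _≢_; _≗_; refl)
open import Relation.Nullary using (Dec; yes; no; ¬?; _×-dec_; _→-dec_)
open import Relation.Nullary.Decidable using (⌊_⌋; map′)
open import Data.Bool.Base using (if_then_else_)

-- The real numbers, as Cauchy sequences of rationals modulo null
-- sequences (the setoid equality _≈_). The Σ-type over N makes the modulus
-- of convergence part of the data.

module Real where

  Seq : Set
  Seq = ℕ → ℚ

  Cauchy : Seq → Set
  Cauchy s = ∀ ε → 0ℚ ℚ.< ε →
    ∃[ N ] ∀ m n → N ℕ.≤ m → N ℕ.≤ n → ℚ.∣ s m ℚ.- s n ∣ ℚ.< ε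

  record ℝ : Set where
    constructor mkℝ
    field
      seq    : Seq
      cauchy : Cauchy seq

  open ℝ public

  infix 4 _≈_
  record _≈_ (x y : ℝ) : Set where
    constructor mk≈
    field
      close : ∀ ε → 0ℚ ℚ.< ε →
        ∃[ N ] ∀ n → N ℕ.≤ n → ℚ.∣ seq x n ℚ.- seq y n ∣ ℚ.< ε

  open _≈_ public

  private
    half-pos : ∀ {ε} → 0ℚ ℚ.< ε → 0ℚ ℚ.< ½ ℚ.* ε
    half-pos {ε} 0<ε = ℚ.*-monoʳ-<-pos ½ 0<ε

    halves : ∀ ε → ½ ℚ.* ε ℚ.+ ½ ℚ.* ε ≡ ε
    halves ε = ≡.trans (≡.sym (ℚ.*-distribʳ-+ ε ½ ½)) (ℚ.*-identityˡ ε)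

    ∣+∣< : ∀ ε u v → ℚ.∣ u ∣ ℚ.< ½ ℚ.* ε → ℚ.∣ v ∣ ℚ.< ½ ℚ.* ε → ℚ.∣ u ℚ.+ v ∣ ℚ.< ε
    ∣+∣< ε u v p q = ≡.subst (ℚ.∣ u ℚ.+ v ∣ ℚ.<_) (halves ε)
      (ℚ.≤-<-trans (ℚ.∣p+q∣≤∣p∣+∣q∣ u v) (ℚ.+-mono-< p q))

    ∣0∣< : ∀ {ε p} → p ≡ 0ℚ → 0ℚ ℚ.< ε → ℚ.∣ p ∣ ℚ.< ε
    ∣0∣< refl 0<ε = 0<ε

    open ℚ.+-*-Solver

    tol : ℚ → ∀ B → 0ℚ ℚ.< B → ℚ
    tol ε B 0<B = (½ ℚ.* ε) ℚ.* (ℚ.1/ B) {{ℚ.>-nonZero 0<B}}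

    tol-pos : ∀ {ε} B (0<B : 0ℚ ℚ.< B) → 0ℚ ℚ.< ε → 0ℚ ℚ.< tol ε B 0<B
    tol-pos {ε} B 0<B 0<ε = ℚ.positive⁻¹ _
      {{ℚ.pos*pos⇒pos (½ ℚ.* ε) {{ℚ.positive (half-pos 0<ε)}} _
          {{ℚ.1/pos⇒pos B {{ℚ.positive 0<B}}}}}}

    B*tol : ∀ ε B (0<B : 0ℚ ℚ.< B) → B ℚ.* tol ε B 0<B ≡ ½ ℚ.* ε
    B*tol ε B 0<B = ≡.trans (solve 3 (λ b h r → b :* (h :* r) := h :* (b :* r)) refl B (½ ℚ.* ε) _)
      (≡.trans (≡.cong ((½ ℚ.* ε) ℚ.*_) (ℚ.*-inverseʳ B {{ℚ.>-nonZero 0<B}})) (ℚ.*-identityʳ _))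

    ∣*∣< : ∀ ε B (0<B : 0ℚ ℚ.< B) u v → ℚ.∣ u ∣ ℚ.< B → ℚ.∣ v ∣ ℚ.< tol ε B 0<B →
           ℚ.∣ u ℚ.* v ∣ ℚ.< ½ ℚ.* ε
    ∣*∣< ε B 0<B u v u<B v<t = begin-strict
      ℚ.∣ u ℚ.* v ∣          ≡⟨ ℚ.∣p*q∣≡∣p∣*∣q∣ u v ⟩
      ℚ.∣ u ∣ ℚ.* ℚ.∣ v ∣    ≤⟨ ℚ.*-monoʳ-≤-nonNeg ℚ.∣ v ∣ {{ℚ.∣-∣-nonNeg v}} (ℚ.<⇒≤ u<B) ⟩
      B ℚ.* ℚ.∣ v ∣          <⟨ ℚ.*-monoʳ-<-pos B {{ℚ.positive 0<B}} v<t ⟩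
      B ℚ.* tol ε B 0<B      ≡⟨ B*tol ε B 0<B ⟩
      ½ ℚ.* ε                ∎
      where open ℚ.≤-Reasoning

    ∣+∣-close : ∀ ε a a′ b b′ → ℚ.∣ a ℚ.- a′ ∣ ℚ.< ½ ℚ.* ε → ℚ.∣ b ℚ.- b′ ∣ ℚ.< ½ ℚ.* ε →
                ℚ.∣ (a ℚ.+ b) ℚ.- (a′ ℚ.+ b′) ∣ ℚ.< ε
    ∣+∣-close ε a a′ b b′ p q = ≡.subst (λ z → ℚ.∣ z ∣ ℚ.< ε)
      (solve 4 (λ a a′ b b′ → (a :+ :- a′) :+ (b :+ :- b′) := (a :+ b) :+ :- (a′ :+ b′)) refl a a′ b b′)
      (∣+∣< ε (a ℚ.- a′) (b ℚ.- b′) p q)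

    ∣*∣-close : ∀ ε B C (0<B : 0ℚ ℚ.< B) (0<C : 0ℚ ℚ.< C) a a′ b b′ →
                ℚ.∣ a ∣ ℚ.< B → ℚ.∣ b′ ∣ ℚ.< C →
                ℚ.∣ a ℚ.- a′ ∣ ℚ.< tol ε C 0<C → ℚ.∣ b ℚ.- b′ ∣ ℚ.< tol ε B 0<B →
                ℚ.∣ a ℚ.* b ℚ.- a′ ℚ.* b′ ∣ ℚ.< ε
    ∣*∣-close ε B C 0<B 0<C a a′ b b′ a<B b′<C p q = ≡.subst (λ z → ℚ.∣ z ∣ ℚ.< ε)
      (solve 4 (λ a a′ b b′ → a :* (b :+ :- b′) :+ b′ :* (a :+ :- a′) := a :* b :+ :- (a′ :* b′))
        refl a a′ b b′)
      (∣+∣< ε (a ℚ.* (b ℚ.- b′)) (b′ ℚ.* (a ℚ.- a′))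
        (∣*∣< ε B 0<B a (b ℚ.- b′) a<B q) (∣*∣< ε C 0<C b′ (a ℚ.- a′) b′<C p))

    ∣neg∣ : ∀ a b → ℚ.∣ a ℚ.- b ∣ ≡ ℚ.∣ (ℚ.- a) ℚ.- (ℚ.- b) ∣
    ∣neg∣ a b = ≡.trans (≡.sym (ℚ.∣-p∣≡∣p∣ (a ℚ.- b)))
      (≡.cong ℚ.∣_∣ (solve 2 (λ a b → :- (a :+ :- b) := (:- a) :+ :- (:- b)) refl a b))

    module _ {M N : ℕ} where
      ⊔ˡ : ∀ {n} → M ℕ.⊔ N ℕ.≤ n → M ℕ.≤ n
      ⊔ˡ = ℕ.m⊔n≤o⇒m≤o M N
      ⊔ʳ : ∀ {n} → M ℕ.⊔ N ℕ.≤ n → N ℕ.≤ n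
      ⊔ʳ = ℕ.m⊔n≤o⇒n≤o M N

    bound : ∀ x → ∃[ B ] 0ℚ ℚ.< B × ∃[ N ] (∀ n → N ℕ.≤ n → ℚ.∣ seq x n ∣ ℚ.< B)
    bound x with cauchy x 1ℚ (ℚ.positive⁻¹ 1ℚ)
    ... | N , h = B , 0<B , N , below
      where
      B = 1ℚ ℚ.+ ℚ.∣ seq x N ∣
      0<B : 0ℚ ℚ.< B
      0<B = ℚ.+-mono-<-≤ (ℚ.positive⁻¹ 1ℚ) (ℚ.0≤∣p∣ (seq x N))
      below : ∀ n → N ℕ.≤ n → ℚ.∣ seq x n ∣ ℚ.< B
      below n N≤n = ℚ.≤-<-trans
        (≡.subst (λ z → ℚ.∣ z ∣ ℚ.≤ ℚ.∣ seq x n ℚ.- seq x N ∣ ℚ.+ ℚ.∣ seq x N ∣)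
          (solve 2 (λ a b → (a :+ :- b) :+ b := a) refl (seq x n) (seq x N))
          (ℚ.∣p+q∣≤∣p∣+∣q∣ (seq x n ℚ.- seq x N) (seq x N)))
        (ℚ.+-monoˡ-< ℚ.∣ seq x N ∣ (h n N N≤n ℕ.≤-refl))

  infixl 6 _+_
  infixl 7 _*_
  infix  8 -_

  fromℚ : ℚ → ℝ
  fromℚ q = mkℝ (λ _ → q) λ ε 0<ε → 0 , λ _ _ _ _ → ∣0∣< (ℚ.+-inverseʳ q) 0<ε

  _+_ : ℝ → ℝ → ℝ
  x + y = mkℝ (λ n → seq x n ℚ.+ seq y n) λ ε 0<ε →
    let M , f = cauchy x (½ ℚ.* ε) (half-pos 0<ε)
        N , g = cauchy y (½ ℚ.* ε) (half-pos 0<ε)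
    in M ℕ.⊔ N , λ m n p q →
       ∣+∣-close ε (seq x m) (seq x n) (seq y m) (seq y n)
         (f m n (⊔ˡ p) (⊔ˡ q)) (g m n (⊔ʳ {M} p) (⊔ʳ {M} q))

  _*_ : ℝ → ℝ → ℝ
  x * y = mkℝ (λ n → seq x n ℚ.* seq y n) λ ε 0<ε →
    let B , 0<B , K , x<B = bound x
        C , 0<C , L , y<C = bound y
        M , f = cauchy x (tol ε C 0<C) (tol-pos C 0<C 0<ε)
        N , g = cauchy y (tol ε B 0<B) (tol-pos B 0<B 0<ε)
    in (K ℕ.⊔ L) ℕ.⊔ (M ℕ.⊔ N) , λ m n p q →
       ∣*∣-close ε B C 0<B 0<C (seq x m) (seq x n) (seq y m) (seq y n)
         (x<B m (⊔ˡ {K} (⊔ˡ {K ℕ.⊔ L} p))) (y<C n (⊔ʳ {K} (⊔ˡ {K ℕ.⊔ L} q)))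
         (f m n (⊔ˡ (⊔ʳ {K ℕ.⊔ L} p)) (⊔ˡ (⊔ʳ {K ℕ.⊔ L} q)))
         (g m n (⊔ʳ {M} (⊔ʳ {K ℕ.⊔ L} p)) (⊔ʳ {M} (⊔ʳ {K ℕ.⊔ L} q)))

  -_ : ℝ → ℝ
  - x = mkℝ (λ n → ℚ.- seq x n) λ ε 0<ε →
    map₂ (λ f m n p q → ≡.subst (ℚ._< ε) (∣neg∣ (seq x m) (seq x n)) (f m n p q)) (cauchy x ε 0<ε)

  ≗⇒≈ : ∀ {x y} → seq x ≗ seq y → x ≈ y
  ≗⇒≈ {x} {y} x≗y = mk≈ λ ε 0<ε → 0 , λ n _ →
    ∣0∣< (≡.trans (≡.cong (ℚ._- seq y n) (x≗y n)) (ℚ.+-inverseʳ (seq y n))) 0<ε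

  private
    ≈-sym : ∀ {x y} → x ≈ y → y ≈ x
    ≈-sym {x} {y} x≈y = mk≈ λ ε 0<ε →
      map₂ (λ f n p → ≡.subst (ℚ._< ε) (flip-∣-∣ (seq x n) (seq y n)) (f n p)) (close x≈y ε 0<ε)
      where
      flip-∣-∣ : ∀ a b → ℚ.∣ a ℚ.- b ∣ ≡ ℚ.∣ b ℚ.- a ∣
      flip-∣-∣ a b = ≡.trans (≡.sym (ℚ.∣-p∣≡∣p∣ (a ℚ.- b)))
        (≡.cong ℚ.∣_∣ (solve 2 (λ a b → :- (a :+ :- b) := b :+ :- a) refl a b))

    ≈-trans : ∀ {x y z} → x ≈ y → y ≈ z → x ≈ z
    ≈-trans {x} {y} {z} x≈y y≈z = mk≈ λ ε 0<ε →
      let M , f = close x≈y (½ ℚ.* ε) (half-pos 0<ε)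
          N , g = close y≈z (½ ℚ.* ε) (half-pos 0<ε)
      in M ℕ.⊔ N , λ n p → ≡.subst (λ w → ℚ.∣ w ∣ ℚ.< ε)
           (solve 3 (λ a b c → (a :+ :- b) :+ (b :+ :- c) := a :+ :- c) refl (seq x n) (seq y n) (seq z n))
           (∣+∣< ε (seq x n ℚ.- seq y n) (seq y n ℚ.- seq z n) (f n (⊔ˡ p)) (g n (⊔ʳ {M} p)))

    +-cong : Congruent₂ _≈_ _+_
    +-cong {x} {x′} {y} {y′} x≈ y≈ = mk≈ λ ε 0<ε →
      let M , f = close x≈ (½ ℚ.* ε) (half-pos 0<ε)
          N , g = close y≈ (½ ℚ.* ε) (half-pos 0<ε)
      in M ℕ.⊔ N , λ n p →
         ∣+∣-close ε (seq x n) (seq x′ n) (seq y n) (seq y′ n) (f n (⊔ˡ p)) (g n (⊔ʳ {M} p))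

    *-cong : Congruent₂ _≈_ _*_
    *-cong {x} {x′} {y} {y′} x≈ y≈ = mk≈ λ ε 0<ε →
      let B , 0<B , K , x<B = bound x
          C , 0<C , L , y<C = bound y′
          M , f = close x≈ (tol ε C 0<C) (tol-pos C 0<C 0<ε)
          N , g = close y≈ (tol ε B 0<B) (tol-pos B 0<B 0<ε)
      in (K ℕ.⊔ L) ℕ.⊔ (M ℕ.⊔ N) , λ n p →
         ∣*∣-close ε B C 0<B 0<C (seq x n) (seq x′ n) (seq y n) (seq y′ n)
           (x<B n (⊔ˡ {K} (⊔ˡ {K ℕ.⊔ L} p))) (y<C n (⊔ʳ {K} (⊔ˡ {K ℕ.⊔ L} p)))
           (f n (⊔ˡ (⊔ʳ {K ℕ.⊔ L} p))) (g n (⊔ʳ {M} (⊔ʳ {K ℕ.⊔ L} p)))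

    -‿cong : ∀ {x y} → x ≈ y → - x ≈ - y
    -‿cong {x} {y} x≈y = mk≈ λ ε 0<ε →
      map₂ (λ f n p → ≡.subst (ℚ._< ε) (∣neg∣ (seq x n) (seq y n)) (f n p)) (close x≈y ε 0<ε)

  ℝ-commutativeRing : CommutativeRing 0ℓ 0ℓ
  ℝ-commutativeRing = record
    { Carrier = ℝ ; _≈_ = _≈_ ; _+_ = _+_ ; _*_ = _*_ ; -_ = -_ ; 0# = fromℚ 0ℚ ; 1# = fromℚ 1ℚ
    ; isCommutativeRing = record
      { isRing = record
        { +-isAbelianGroup = record
          { isGroup = record
            { isMonoid = record
              { isSemigroup = record
                { isMagma = record
                  { isEquivalence = record
                    { refl  = ≗⇒≈ λ _ → refl
                    ; sym   = ≈-sym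
                    ; trans = ≈-trans
                    }
                  ; ∙-cong = +-cong
                  }
                ; assoc = λ x y z → ≗⇒≈ λ n → ℚ.+-assoc (seq x n) (seq y n) (seq z n)
                }
              ; identity = (λ x → ≗⇒≈ λ n → ℚ.+-identityˡ (seq x n))
                         , (λ x → ≗⇒≈ λ n → ℚ.+-identityʳ (seq x n))
              }
            ; inverse = (λ x → ≗⇒≈ λ n → ℚ.+-inverseˡ (seq x n))
                      , (λ x → ≗⇒≈ λ n → ℚ.+-inverseʳ (seq x n))
            ; ⁻¹-cong = -‿cong
            }
          ; comm = λ x y → ≗⇒≈ λ n → ℚ.+-comm (seq x n) (seq y n)
          }
        ; *-cong = *-cong
        ; *-assoc = λ x y z → ≗⇒≈ λ n → ℚ.*-assoc (seq x n) (seq y n) (seq z n)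
        ; *-identity = (λ x → ≗⇒≈ λ n → ℚ.*-identityˡ (seq x n))
                     , (λ x → ≗⇒≈ λ n → ℚ.*-identityʳ (seq x n))
        ; distrib = (λ x y z → ≗⇒≈ {x * (y + z)} {(x * y) + (x * z)}
                       λ n → ℚ.*-distribˡ-+ (seq x n) (seq y n) (seq z n))
                  , (λ x y z → ≗⇒≈ {(y + z) * x} {(y * x) + (z * x)}
                       λ n → ℚ.*-distribʳ-+ (seq x n) (seq y n) (seq z n))
        }
      ; *-comm = λ x y → ≗⇒≈ λ n → ℚ.*-comm (seq x n) (seq y n)
      }
    }

-- Adjoining a square root of -1 to a commutative ring: the pair (a , b)
-- stands for a + b𝐢.

module Complexify {c ℓ} (R : CommutativeRing c ℓ) where

  open CommutativeRing R

  open RingProperties ring using (-‿distribˡ-*; -‿distribʳ-*; -‿+-comm; -0#≈0#)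

  private
    open SemiringSolver commutativeSemiring using (solve; _:+_; _:*_; _:=_)

    +-pair : AbelianGroup c ℓ
    +-pair = DirectProduct.abelianGroup +-abelianGroup +-abelianGroup

  _⊛_ : Carrier × Carrier → Carrier × Carrier → Carrier × Carrier
  (a , b) ⊛ (c , d) = a * c - b * d , a * d + b * c

  commutativeRing : CommutativeRing c ℓ
  commutativeRing = record
    { Carrier = Carrier × Carrier
    ; _≈_ = AbelianGroup._≈_ +-pair
    ; _+_ = AbelianGroup._∙_ +-pair
    ; _*_ = _⊛_
    ; -_  = AbelianGroup._⁻¹ +-pair
    ; 0#  = 0# , 0#
    ; 1#  = 1# , 0#
    ; isCommutativeRing = record
      { isRing = record
        { +-isAbelianGroup = AbelianGroup.isAbelianGroup +-pair
        ; *-cong = λ (a≈ , b≈) (c≈ , d≈) →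
            +-cong (*-cong a≈ c≈) (-‿cong (*-cong b≈ d≈)) , +-cong (*-cong a≈ d≈) (*-cong b≈ c≈)
        ; *-assoc = assoc²
        ; *-identity = identityˡ , λ x → ≈².trans (comm² x (1# , 0#)) (identityˡ x)
        ; distrib = distribˡ² , λ x y z → ≈².trans (comm² (y +² z) x)
            (≈².trans (distribˡ² x y z) (AbelianGroup.∙-cong +-pair (comm² x y) (comm² x z)))
        }
      ; *-comm = comm²
      }
    }
    where
    module ≈² = AbelianGroup +-pair
    -*ˡ = -‿distribˡ-*
    -*ʳ = -‿distribʳ-*
    _+²_ = AbelianGroup._∙_ +-pair
    comm² : ∀ x y → (x ⊛ y) ≈².≈ (y ⊛ x)
    comm² (a , b) (c , d) =
        +-cong (*-comm a c) (-‿cong (*-comm b d))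
      , trans (+-comm (a * d) (b * c)) (+-cong (*-comm b c) (*-comm a d))
    identityˡ : ∀ x → ((1# , 0#) ⊛ x) ≈².≈ x
    identityˡ (a , b) =
        trans (+-cong (*-identityˡ a) (trans (-‿cong (zeroˡ b)) -0#≈0#)) (+-identityʳ a)
      , trans (+-cong (*-identityˡ b) (zeroˡ a)) (+-identityʳ b)
    distribˡ² : ∀ x y z → (x ⊛ (y +² z)) ≈².≈ ((x ⊛ y) +² (x ⊛ z))
    distribˡ² (a , b) (c , d) (e , f) =
        trans (+-congˡ (-*ˡ b (d + f)))
          (trans
            (solve 6 (λ a b′ c d e f →
                a :* (c :+ e) :+ b′ :* (d :+ f) := (a :* c :+ b′ :* d) :+ (a :* e :+ b′ :* f))
              (CommutativeRing.refl R) a (- b) c d e f)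
            (sym (+-cong (+-congˡ (-*ˡ b d)) (+-congˡ (-*ˡ b f)))))
      , solve 6 (λ a b c d e f →
            a :* (d :+ f) :+ b :* (c :+ e) := (a :* d :+ b :* c) :+ (a :* f :+ b :* e))
          (CommutativeRing.refl R) a b c d e f
    assoc² : ∀ x y z → ((x ⊛ y) ⊛ z) ≈².≈ (x ⊛ (y ⊛ z))
    assoc² (a , b) (c , d) (e , f) =
        trans (+-cong (*-congʳ (+-congˡ (-*ʳ b d))) (-*ʳ (a * d + b * c) f))
          (trans
            (solve 8 (λ a b c d d′ e f f′ →
                (a :* c :+ b :* d′) :* e :+ (a :* d :+ b :* c) :* f′ :=
                a :* (c :* e :+ d :* f′) :+ b :* (c :* f′ :+ d′ :* e))
              (CommutativeRing.refl R) a b c d (- d) e f (- f))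
            (sym (+-cong (*-congˡ (+-congˡ (-*ʳ d f)))
              (trans (-*ʳ b (c * f + d * e))
                (*-congˡ (trans (sym (-‿+-comm (c * f) (d * e)))
                  (+-cong (-*ʳ c f) (-*ˡ d e))))))))
      , trans (+-congʳ (*-congʳ (+-congˡ (-*ʳ b d))))
          (trans
            (solve 7 (λ a b c d d′ e f →
                (a :* c :+ b :* d′) :* f :+ (a :* d :+ b :* c) :* e :=
                a :* (c :* f :+ d :* e) :+ b :* (c :* e :+ d′ :* f))
              (CommutativeRing.refl R) a b c d (- d) e f)
            (+-congˡ (*-congˡ (+-congˡ (sym (-*ˡ d f))))))

ℂ-commutativeRing : CommutativeRing 0ℓ 0ℓ
ℂ-commutativeRing = Complexify.commutativeRing Real.ℝ-commutativeRing

open CommutativeRing ℂ-commutativeRing public using () renaming (Carrier to ℂ)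

𝐢 : ℂ
𝐢 = Real.fromℚ 0ℚ , Real.fromℚ 1ℚ

½ℂ : ℂ
½ℂ = Real.fromℚ ½ , Real.fromℚ 0ℚ

X : ℕ → Set
X D = Vec (Fin 2) D

_≟_ : ∀ {D} (y z : X D) → Dec (y ≡ z)
_≟_ = Vec.≡-dec Fin._≟_

Adjacent : ∀ {D} → X D → X D → Set
Adjacent y z = ∃! _≡_ λ k → lookup y k ≢ lookup z k

data Walk {D} : ℕ → X D → X D → Set where
  []  : ∀ {y} → Walk 0 y y
  _∷_ : ∀ {n y w z} → Adjacent y w → Walk n w z → Walk (suc n) y z

-- A walk of least length is a path, so d is the length of a shortest path.
IsDistance : ∀ {D} → X D → X D → ℕ → Set
IsDistance y z d = Walk d y z × (∀ n → Walk n y z → d ℕ.≤ n)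

adjacent? : ∀ {D} (y z : X D) → Dec (Adjacent y z)
adjacent? y z = map′
  (λ (k , p , u) → k , p , λ {j} → u j)
  (λ (k , p , u) → k , p , λ j → u {j})
  (Fin.any? λ k → differ? k ×-dec Fin.all? λ j → differ? j →-dec k Fin.≟ j)
  where
  differ? : ∀ k → Dec (lookup y k ≢ lookup z k)
  differ? k = ¬? (lookup y k Fin.≟ lookup z k)

private
  anyX? : ∀ {D} {P : X D → Set} → (∀ y → Dec (P y)) → Dec (∃ P)
  anyX? {zero}  P? = map′ ([] ,_) (λ { ([] , p) → p }) (P? [])
  anyX? {suc D} P? = map′ (λ (b , y , p) → b ∷ y , p) (λ { (b ∷ y , p) → b , y , p })
    (Fin.any? λ b → anyX? λ y → P? (b ∷ y))

  walk? : ∀ {D} n (y z : X D) → Dec (Walk n y z)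
  walk? zero    y z = map′ (λ { refl → [] }) (λ { [] → refl }) (y ≟ z)
  walk? (suc n) y z = map′ (λ (w , a , p) → a ∷ p) (λ { (a ∷ p) → _ , a , p })
    (anyX? λ w → adjacent? y w ×-dec walk? n w z)

  least : ∀ {P : ℕ → Set} → (∀ n → Dec (P n)) → ∀ n → P n → ∃[ d ] P d × (∀ m → P m → d ℕ.≤ m)
  least P? n p with P? 0
  ... | yes p₀ = 0 , p₀ , λ _ _ → ℕ.z≤n
  least P? zero    p | no ¬p₀ = ⊥-elim (¬p₀ p)
  least P? (suc n) p | no ¬p₀ with least (λ m → P? (suc m)) n p
  ... | d , q , min = suc d , q , λ { zero r → ⊥-elim (¬p₀ r) ; (suc m) r → ℕ.s≤s (min m r) }

  adjacent-∷ : ∀ {D} b {y z : X D} → Adjacent y z → Adjacent (b ∷ y) (b ∷ z)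
  adjacent-∷ b (k , p , u) = suc k , p , λ { {zero} q → ⊥-elim (q refl) ; {suc j} q → ≡.cong suc (u q) }

  walk-∷ : ∀ {D n} b {y z : X D} → Walk n y z → Walk n (b ∷ y) (b ∷ z)
  walk-∷ b []      = []
  walk-∷ b (a ∷ p) = adjacent-∷ b a ∷ walk-∷ b p

  connected : ∀ {D} (y z : X D) → ∃[ n ] Walk n y z
  connected []      []      = 0 , []
  connected (b ∷ y) (c ∷ z) with b Fin.≟ c | connected y z
  ... | yes refl | n , p = n , walk-∷ b p
  ... | no b≢c   | n , p = suc n ,
        (zero , b≢c , λ { {zero} _ → refl ; {suc j} q → ⊥-elim (q refl) }) ∷ walk-∷ c p

distance : ∀ {D} (y z : X D) → ∃ (IsDistance y z)
distance y z = let n , p = connected y z in least (λ m → walk? m y z) n p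

∂ : ∀ {D} → X D → X D → ℕ
∂ y z = proj₁ (distance y z)

-- The parameters 𝐢 and ½ are instantiated below with the complex numbers
-- of these names.
module CubeMatrices {c ℓ} (R : CommutativeRing c ℓ)
                    (𝐢 ½ : CommutativeRing.Carrier R) where

  open CommutativeRing R hiding (zero)
  open RawMonoidDefs (CommutativeMonoid.rawMonoid +-commutativeMonoid)
    using (sum) renaming (_×_ to _×#_)
  open RawMonoidDefs (CommutativeMonoid.rawMonoid *-commutativeMonoid)
    using () renaming (sum to product)

  Mat : ℕ → Set c
  Mat D = X D → X D → Carrier

  infix 4 _≋_
  _≋_ : ∀ {D} → Rel (Mat D) ℓ
  M ≋ N = ∀ y z → M y z ≈ N y z

  ∑X : ∀ {D} → (X D → Carrier) → Carrier
  ∑X {zero}  f = f []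
  ∑X {suc D} f = sum λ b → ∑X λ y → f (b ∷ y)

  infixl 7 _·_
  _·_ : ∀ {D} → Mat D → Mat D → Mat D
  (M · N) y z = ∑X λ w → M y w * N w z

  infixl 6 _⊖_
  _⊖_ : ∀ {D} → Mat D → Mat D → Mat D
  (M ⊖ N) y z = M y z - N y z

  infixr 8 _⊙_
  _⊙_ : ∀ {D} → Carrier → Mat D → Mat D
  (a ⊙ M) y z = a * M y z

  diagonal : ∀ {D} → (X D → Carrier) → Mat D
  diagonal f y z = if ⌊ y ≟ z ⌋ then f y else 0#

  I : ∀ {D} → Mat D
  I = diagonal λ _ → 1#

  A : ∀ D → Mat D
  A D y z = if ⌊ adjacent? y z ⌋ then 1# else 0#

  x₀ : ∀ D → X D
  x₀ D = replicate D zero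

  A* : ∀ D → Mat D
  A* D = diagonal λ y → D ×# 1# - (2 ℕ.* ∂ (x₀ D) y) ×# 1#

  Aᵋ : ∀ D → Mat D
  Aᵋ D = ½ ⊙ (- 𝐢) ⊙ (A D · A* D ⊖ A* D · A D)

  P₁ : Fin 2 → Fin 2 → Carrier
  P₁ zero       zero       = 1#
  P₁ zero       (suc zero) = 1#
  P₁ (suc zero) zero       = - 𝐢
  P₁ (suc zero) (suc zero) = 𝐢

  P : ∀ D → Mat D
  P D y z = product {D} λ k → P₁ (lookup y k) (lookup z k)

open CubeMatrices ℂ-commutativeRing 𝐢 ½ℂ public

{-# OPTIONS --safe #-}
module Submission where

-- Over the D-fold tensor power of a two-dimensional space, A, A* and Aᵋ are
-- the operators δ m = ∑ₖ 1 ⊗ ⋯ ⊗ m ⊗ ⋯ ⊗ 1 (m in position k) for the 2 × 2 matrices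
-- [[0,1],[1,0]], [[1,0],[0,-1]] and [[0,𝐢],[-𝐢,0]]: for A by splitting off a
-- coordinate, for A* because the distance to (0,…,0) is the number of ones,
-- and for Aᵋ because δ preserves commutators. Conjugating δ m by P = P₁⊗⋯⊗P₁
-- gives δ (P₁ m P₁⁻¹), so the theorem reduces to D = 1, where P₁ permutes the
-- three matrices cyclically.

open import Algebra.Bundles using (CommutativeRing)
open import Algebra.Core using (Op₂)
open import Algebra.Definitions using (Invertible)
open import Data.Bool.Base using (true; false; if_then_else_)
open import Data.Fin.Base using (Fin; zero; suc; toℕ)
open import Data.Fin.Patterns using (0F; 1F)
import Data.Fin.Properties as Fin
open import Data.Nat.Base as ℕ using (ℕ; zero; suc; NonZero; z≤n; s≤s)
import Data.Nat.Properties as ℕ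
open import Data.Product using (Σ-syntax; _×_; _,_; proj₁; proj₂; uncurry)
open import Data.Rational.Base using (ℚ)
open import Data.Vec.Base using (Vec; []; _∷_; lookup; replicate; tabulate)
open import Data.Vec.Properties using (∷-injective; lookup∘tabulate)
open import Data.Vec.Relation.Binary.Pointwise.Extensional using (ext; Pointwise-≡⇒≡)
open import Function.Base using (_∘_)
open import Function.Bundles using (_⇔_; mk⇔; module Equivalence)
open import Level using (_⊔_)
open import Relation.Binary.Bundles using (Setoid)
open import Relation.Binary.Core using (Rel)
open import Relation.Binary.PropositionalEquality as ≡ using (_≡_; _≢_; _≗_; refl)
open import Relation.Nullary using (Dec; yes; no; ¬?; _×-dec_; contradiction)
open import Relation.Nullary.Decidable using (⌊_⌋; isYes≗does; does-⇔; decidable-stable)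

open import Defs using (X; _≟_; Adjacent; Walk; []; _∷_; adjacent?; distance; ∂; module CubeMatrices)

-- Adjacency, and distance from the origin.

Adjacent-∷-≡ : ∀ {D} b {y z : X D} → Adjacent (b ∷ y) (b ∷ z) ⇔ Adjacent y z
Adjacent-∷-≡ b = mk⇔
  (λ { (zero  , p , u) → contradiction refl p
     ; (suc k , p , u) → k , p , λ q → Fin.suc-injective (u q) })
  (λ (k , p , u) → suc k , p , λ
     { {zero}  q → contradiction refl q
     ; {suc j} q → ≡.cong suc (u q) })

Adjacent-∷-≢ : ∀ {D b c} {y z : X D} → b ≢ c → Adjacent (b ∷ y) (c ∷ z) ⇔ y ≡ z
Adjacent-∷-≢ {y = y} {z} b≢c = mk⇔
  (λ { (zero  , _ , u) → Pointwise-≡⇒≡ (ext λ j →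
         -- A difference at `j` in the tails would, by uniqueness, identify `suc j` with `zero`.
         decidable-stable (lookup y j Fin.≟ lookup z j) λ p → contradiction (u {suc j} p) λ ())
     ; (suc k , _ , u) → contradiction (u {zero} b≢c) λ () })
  (λ { refl → zero , b≢c , λ
     { {zero}  _ → refl
     ; {suc j} q → contradiction refl q } })

weight : ∀ {D} → X D → ℕ
weight []      = 0
weight (b ∷ y) = toℕ b ℕ.+ weight y

weight-x₀ : ∀ D → weight (replicate D 0F) ≡ 0
weight-x₀ zero    = refl
weight-x₀ (suc D) = weight-x₀ D

Adjacent⇒weight≤ : ∀ {D} (y z : X D) → Adjacent y z → weight z ℕ.≤ suc (weight y)
Adjacent⇒weight≤ []      []      _ = z≤n
Adjacent⇒weight≤ (b ∷ y) (c ∷ z) adj with b Fin.≟ c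
... | yes refl = ℕ.≤-trans
  (ℕ.+-monoʳ-≤ (toℕ b) (Adjacent⇒weight≤ y z (Equivalence.to (Adjacent-∷-≡ b) adj)))
  (ℕ.≤-reflexive (ℕ.+-suc (toℕ b) (weight y)))
... | no b≢c with refl ← Equivalence.to (Adjacent-∷-≢ {y = y} {z} b≢c) adj =
  -- The tails agree, so the `suc` on the right absorbs the new head `c`, which is at most 1.
  ℕ.+-mono-≤ (Fin.toℕ≤pred[n] c) (ℕ.m≤n+m (weight y) (toℕ b))

Walk⇒weight≤ : ∀ {D n} {y z : X D} → Walk n y z → weight z ℕ.≤ n ℕ.+ weight y
Walk⇒weight≤ []                      = ℕ.≤-refl
Walk⇒weight≤ (_∷_ {n} {y} {w} adj p) = ℕ.≤-trans (Walk⇒weight≤ p)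
  (ℕ.≤-trans (ℕ.+-monoʳ-≤ n (Adjacent⇒weight≤ y w adj)) (ℕ.≤-reflexive (ℕ.+-suc n (weight y))))

Walk-∷ : ∀ {D n} b {y z : X D} → Walk n y z → Walk n (b ∷ y) (b ∷ z)
Walk-∷ b []        = []
Walk-∷ b (adj ∷ p) = Equivalence.from (Adjacent-∷-≡ b) adj ∷ Walk-∷ b p

walk-from-x₀ : ∀ {D} (y : X D) → Walk (weight y) (replicate D 0F) y
walk-from-x₀ []       = []
walk-from-x₀ (0F ∷ y) = Walk-∷ 0F (walk-from-x₀ y)
walk-from-x₀ (1F ∷ y) = Equivalence.from (Adjacent-∷-≢ λ ()) refl ∷ Walk-∷ 1F (walk-from-x₀ y)

-- Flipping the ones of `y` one by one gives the upper bound. For the lower bound, each step of a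
-- walk raises the weight by at most one, and the origin has weight zero.
∂-x₀ : ∀ {D} (y : X D) → ∂ (replicate D 0F) y ≡ weight y
∂-x₀ {D} y with distance (replicate D 0F) y
... | d , p , min = ℕ.≤-antisym (min (weight y) (walk-from-x₀ y))
  (≡.subst (weight y ℕ.≤_) (≡.trans (≡.cong (d ℕ.+_) (weight-x₀ D)) (ℕ.+-identityʳ d))
    (Walk⇒weight≤ p))

module TensorPower {c ℓ} (R : CommutativeRing c ℓ) (𝐢 ½ : CommutativeRing.Carrier R) where

  open CommutativeRing R hiding (zero) renaming (refl to ≈-refl)
  open CubeMatrices R 𝐢 ½
  open import Algebra.Properties.Semiring.Sum semiring
  open import Algebra.Properties.Monoid.Mult +-monoid using () renaming (_×_ to _×#_)
  open import Algebra.Properties.Ring ring using (-‿+-comm)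
  open import Algebra.Definitions.RawMonoid *-rawMonoid using () renaming (sum to product)
  open import Algebra.Solver.Ring.NaturalCoefficients.Default commutativeSemiring
    using (solve; _:+_; _:*_; _:=_; con)

  -- Two-by-two matrices and indicators.

  Mat₂ : Set c
  Mat₂ = Fin 2 → Fin 2 → Carrier

  infix 4 _≋₂_
  _≋₂_ : Mat₂ → Mat₂ → Set ℓ
  m ≋₂ n = ∀ b c → m b c ≈ n b c

  infixl 7 _∙_
  infixl 6 _+₂_

  -- Opaque, as are signs and imaginary: otherwise comparing types over ℂ
  -- unfolds these matrices down to the Cauchy moduli of their entries.
  opaque
    _+₂_ : Mat₂ → Mat₂ → Mat₂
    (m +₂ n) b c = m b c + n b c

    _∙_ : Mat₂ → Mat₂ → Mat₂
    (m ∙ n) b c = sum λ a → m b a * n a c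

  𝟙 : ∀ {p} {P : Set p} → Dec P → Carrier
  𝟙 P? = if ⌊ P? ⌋ then 1# else 0#

  -- Lets entries given by decision procedures be compared through the propositions decided, without
  -- unfolding the procedures.
  𝟙-⇔ : ∀ {p q} {P : Set p} {Q : Set q} → P ⇔ Q → (P? : Dec P) (Q? : Dec Q) → 𝟙 P? ≈ 𝟙 Q?
  𝟙-⇔ P⇔Q P? Q? = reflexive (≡.cong (if_then 1# else 0#)
    (≡.trans (isYes≗does P?) (≡.trans (does-⇔ P⇔Q P? Q?) (≡.sym (isYes≗does Q?)))))

  𝟙-× : ∀ {p q} {P : Set p} {Q : Set q} (P? : Dec P) (Q? : Dec Q) → 𝟙 (P? ×-dec Q?) ≈ 𝟙 P? * 𝟙 Q?
  𝟙-× (yes _) (yes _) = sym (*-identityˡ 1#)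
  𝟙-× (yes _) (no _)  = sym (*-identityˡ 0#)
  𝟙-× (no _)  Q?      = sym (zeroˡ (𝟙 Q?))

  I₂ : Mat₂
  I₂ b c = 𝟙 (b Fin.≟ c)

  I₂-siftʳ : ∀ (f : Fin 2 → Carrier) c → sum (λ b → f b * I₂ b c) ≈ f c
  I₂-siftʳ f 0F = solve 2 (λ x y → x :* con 1 :+ (y :* con 0 :+ con 0) := x) ≈-refl (f 0F) (f 1F)
  I₂-siftʳ f 1F = solve 2 (λ x y → x :* con 0 :+ (y :* con 1 :+ con 0) := y) ≈-refl (f 0F) (f 1F)

  I₂-siftˡ : ∀ (f : Fin 2 → Carrier) b → sum (λ c → I₂ b c * f c) ≈ f b
  I₂-siftˡ f 0F = solve 2 (λ x y → con 1 :* x :+ (con 0 :* y :+ con 0) := x) ≈-refl (f 0F) (f 1F)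
  I₂-siftˡ f 1F = solve 2 (λ x y → con 0 :* x :+ (con 1 :* y :+ con 0) := y) ≈-refl (f 0F) (f 1F)

  -- Sums over the vertices.

  ∑X-cong : ∀ {D} {f g : X D → Carrier} → (∀ y → f y ≈ g y) → ∑X f ≈ ∑X g
  ∑X-cong {zero}  f≈g = f≈g []
  ∑X-cong {suc D} f≈g = sum-cong-≋ λ b → ∑X-cong λ y → f≈g (b ∷ y)

  ∑X-distrib-+ : ∀ {D} (f g : X D → Carrier) → ∑X (λ y → f y + g y) ≈ ∑X f + ∑X g
  ∑X-distrib-+ {zero}  f g = ≈-refl
  ∑X-distrib-+ {suc D} f g = trans
    (sum-cong-≋ λ b → ∑X-distrib-+ (f ∘ (b ∷_)) (g ∘ (b ∷_)))
    (∑-distrib-+ (λ b → ∑X (f ∘ (b ∷_))) (λ b → ∑X (g ∘ (b ∷_))))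

  *-distribˡ-∑X : ∀ {D} x (f : X D → Carrier) → x * ∑X f ≈ ∑X (λ y → x * f y)
  *-distribˡ-∑X {zero}  x f = ≈-refl
  *-distribˡ-∑X {suc D} x f = trans (*-distribˡ-sum x (λ b → ∑X (f ∘ (b ∷_))))
    (sum-cong-≋ λ b → *-distribˡ-∑X x (f ∘ (b ∷_)))

  ≋-setoid : ℕ → Setoid c ℓ
  ≋-setoid D = record
    { Carrier = Mat D
    ; _≈_ = _≋_
    ; isEquivalence = record
      { refl  = λ _ _ → ≈-refl
      ; sym   = λ M≋N y z → sym (M≋N y z)
      ; trans = λ M≋N N≋O y z → trans (M≋N y z) (N≋O y z)
      }
    }

  module ≋ {D : ℕ} = Setoid (≋-setoid D) using (refl; sym; trans)

  module ≋-Reasoning {D : ℕ} where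
    open import Relation.Binary.Reasoning.Setoid (≋-setoid D) public

  -- Matrix algebra and tensor products.

  infixl 6 _⊞_
  _⊞_ : ∀ {D} → Mat D → Mat D → Mat D
  (M ⊞ N) y z = M y z + N y z

  infixr 8 _⊗_
  _⊗_ : ∀ {D} → Mat₂ → Mat D → Mat (suc D)
  (m ⊗ M) (b ∷ y) (c ∷ z) = m b c * M y z

  power : Mat₂ → ∀ D → Mat D
  power m D y z = product {D} λ k → m (lookup y k) (lookup z k)

  -- The sum over the coordinates k of the operator acting as m on the k-th
  -- tensor factor and as the identity on the others.
  δ : ∀ {D} → Mat₂ → Mat D
  δ {zero}  m _ _ = 0#
  δ {suc D} m     = I₂ ⊗ δ m ⊞ m ⊗ I

  ⊞-cong : ∀ {D} {M M′ N N′ : Mat D} → M ≋ M′ → N ≋ N′ → M ⊞ N ≋ M′ ⊞ N′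
  ⊞-cong M≋ N≋ y z = +-cong (M≋ y z) (N≋ y z)

  ·-cong : ∀ {D} {M M′ N N′ : Mat D} → M ≋ M′ → N ≋ N′ → M · N ≋ M′ · N′
  ·-cong M≋ N≋ y z = ∑X-cong λ w → *-cong (M≋ y w) (N≋ w z)

  ⊗-cong : ∀ {D} {m m′ : Mat₂} {M M′ : Mat D} → m ≋₂ m′ → M ≋ M′ → m ⊗ M ≋ m′ ⊗ M′
  ⊗-cong m≋ M≋ (b ∷ y) (c ∷ z) = *-cong (m≋ b c) (M≋ y z)

  ·-distribˡ-⊞ : ∀ {D} (M N O : Mat D) → M · (N ⊞ O) ≋ M · N ⊞ M · O
  ·-distribˡ-⊞ M N O y z = trans (∑X-cong λ w → distribˡ (M y w) (N w z) (O w z))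
    (∑X-distrib-+ (λ w → M y w * N w z) (λ w → M y w * O w z))

  ·-distribʳ-⊞ : ∀ {D} (M N O : Mat D) → (N ⊞ O) · M ≋ N · M ⊞ O · M
  ·-distribʳ-⊞ M N O y z = trans (∑X-cong λ w → distribʳ (M w z) (N y w) (O y w))
    (∑X-distrib-+ (λ w → N y w * M w z) (λ w → O y w * M w z))

  opaque
    unfolding _∙_

    -- Commutativity groups the `Mat₂` factors and the `Mat D` factors of each term; the double sum
    -- over head and tail then factors into two sums.
    ⊗-mixed-product : ∀ {D} (m n : Mat₂) (M N : Mat D) → (m ⊗ M) · (n ⊗ N) ≋ (m ∙ n) ⊗ (M · N)
    ⊗-mixed-product m n M N (b ∷ y) (c ∷ z) = trans
      (sum-cong-≋ λ a → trans
        (∑X-cong λ w → solve 4 (λ p q r s → p :* q :* (r :* s) := (p :* r) :* (q :* s)) ≈-refl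
          (m b a) (M y w) (n a c) (N w z))
        (sym (*-distribˡ-∑X (m b a * n a c) λ w → M y w * N w z)))
      (sym (*-distribʳ-sum ((M · N) y z) λ a → m b a * n a c))

  I-∷ : ∀ {D} → I {suc D} ≋ I₂ ⊗ I
  I-∷ (b ∷ y) (c ∷ z) = trans
    (𝟙-⇔ (mk⇔ ∷-injective (uncurry (≡.cong₂ _∷_))) ((b ∷ y) ≟ (c ∷ z)) (b Fin.≟ c ×-dec y ≟ z))
    (𝟙-× (b Fin.≟ c) (y ≟ z))

  ∑X-siftʳ : ∀ {D} (f : X D → Carrier) z → ∑X (λ w → f w * I w z) ≈ f z
  ∑X-siftʳ f []      = *-identityʳ (f [])
  ∑X-siftʳ f (c ∷ z) = trans
    (sum-cong-≋ λ b → trans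
      (∑X-cong λ w → trans (*-congˡ (I-∷ (b ∷ w) (c ∷ z)))
        (solve 3 (λ p q r → p :* (q :* r) := q :* (p :* r)) ≈-refl (f (b ∷ w)) (I₂ b c) (I w z)))
      (trans (sym (*-distribˡ-∑X (I₂ b c) λ w → f (b ∷ w) * I w z))
        (trans (*-congˡ (∑X-siftʳ (f ∘ (b ∷_)) z)) (*-comm (I₂ b c) (f (b ∷ z))))))
    (I₂-siftʳ (λ b → f (b ∷ z)) c)

  ·-identityʳ : ∀ {D} (M : Mat D) → M · I ≋ M
  ·-identityʳ M y = ∑X-siftʳ (M y)

  ·-identityˡ : ∀ {D} (M : Mat D) → I · M ≋ M
  ·-identityˡ M y z = trans
    -- Symmetry of `I` reduces the left law to sifting on the right.
    (∑X-cong λ w → trans (*-congʳ (𝟙-⇔ (mk⇔ ≡.sym ≡.sym) (y ≟ w) (w ≟ y))) (*-comm (I w y) (M w z)))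
    (∑X-siftʳ (λ w → M w z) y)

  opaque
    unfolding _∙_

    ∙-identityˡ : ∀ m → I₂ ∙ m ≋₂ m
    ∙-identityˡ m b c = I₂-siftˡ (λ a → m a c) b

    ∙-identityʳ : ∀ m → m ∙ I₂ ≋₂ m
    ∙-identityʳ m b c = I₂-siftʳ (m b) c

  -- Conjugation by tensor powers.

  power-∷ : ∀ m D → power m (suc D) ≋ m ⊗ power m D
  power-∷ m D (b ∷ y) (c ∷ z) = ≈-refl

  power-inverse : ∀ p q → p ∙ q ≋₂ I₂ → ∀ D → power p D · power q D ≋ I
  power-inverse p q pq zero    [] [] = *-identityˡ 1#
  power-inverse p q pq (suc D) = begin
    power p (suc D) · power q (suc D)       ≈⟨ ·-cong (power-∷ p D) (power-∷ q D) ⟩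
    (p ⊗ power p D) · (q ⊗ power q D)       ≈⟨ ⊗-mixed-product p q (power p D) (power q D) ⟩
    (p ∙ q) ⊗ (power p D · power q D)       ≈⟨ ⊗-cong pq (power-inverse p q pq D) ⟩
    I₂ ⊗ I                                  ≈⟨ I-∷ ⟨
    I                                       ∎
    where open ≋-Reasoning

  -- In the summand with `m` at position k, every other tensor factor becomes `p ∙ q` and cancels,
  -- while the k-th becomes `p ∙ m ∙ q`. The induction splits off the first factor.
  δ-conjugate : ∀ p q m m′ → p ∙ q ≋₂ I₂ → p ∙ m ∙ q ≋₂ m′ →
                ∀ D → power p D · δ m · power q D ≋ δ m′
  -- In dimension 0 the powers are the empty product `1#` and both `δ` are `0#`.
  δ-conjugate p q m m′ pq pmq zero    [] [] = trans (*-congʳ (zeroʳ 1#)) (zeroˡ 1#)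
  δ-conjugate p q m m′ pq pmq (suc D) = begin
    power p (suc D) · δ m · power q (suc D)
      ≈⟨ ·-cong (·-cong (power-∷ p D) (≋.refl {x = δ m})) (power-∷ q D) ⟩
    (p ⊗ P′) · (I₂ ⊗ δ m ⊞ m ⊗ I) · (q ⊗ Q′)
      ≈⟨ ·-cong (·-distribˡ-⊞ (p ⊗ P′) (I₂ ⊗ δ m) (m ⊗ I)) (≋.refl {x = q ⊗ Q′}) ⟩
    ((p ⊗ P′) · (I₂ ⊗ δ m) ⊞ (p ⊗ P′) · (m ⊗ I)) · (q ⊗ Q′)
      ≈⟨ ·-cong (⊞-cong (⊗-mixed-product p I₂ P′ (δ m)) (⊗-mixed-product p m P′ I))
           (≋.refl {x = q ⊗ Q′}) ⟩
    ((p ∙ I₂) ⊗ (P′ · δ m) ⊞ (p ∙ m) ⊗ (P′ · I)) · (q ⊗ Q′)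
      ≈⟨ ·-cong (⊞-cong (⊗-cong (∙-identityʳ p) (≋.refl {x = P′ · δ m}))
                        (⊗-cong {m = p ∙ m} (λ _ _ → ≈-refl) (·-identityʳ P′)))
           (≋.refl {x = q ⊗ Q′}) ⟩
    (p ⊗ (P′ · δ m) ⊞ (p ∙ m) ⊗ P′) · (q ⊗ Q′)
      ≈⟨ ·-distribʳ-⊞ (q ⊗ Q′) (p ⊗ (P′ · δ m)) ((p ∙ m) ⊗ P′) ⟩
    (p ⊗ (P′ · δ m)) · (q ⊗ Q′) ⊞ ((p ∙ m) ⊗ P′) · (q ⊗ Q′)
      ≈⟨ ⊞-cong (⊗-mixed-product p q (P′ · δ m) Q′) (⊗-mixed-product (p ∙ m) q P′ Q′) ⟩
    (p ∙ q) ⊗ (P′ · δ m · Q′) ⊞ (p ∙ m ∙ q) ⊗ (P′ · Q′)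
      ≈⟨ ⊞-cong (⊗-cong pq (δ-conjugate p q m m′ pq pmq D)) (⊗-cong pmq (power-inverse p q pq D)) ⟩
    I₂ ⊗ δ m′ ⊞ m′ ⊗ I ∎
    where
    open ≋-Reasoning
    P′ = power p D
    Q′ = power q D

  -- Scalar multiples, products and commutators of `δ`.

  δ-scale : ∀ {D} x m → x ⊙ δ {D} m ≋ δ (λ b c → x * m b c)
  δ-scale {zero}  x m y z = zeroʳ x
  δ-scale {suc D} x m (b ∷ y) (c ∷ z) = trans
    (solve 5 (λ x i d m e → x :* (i :* d :+ m :* e) := i :* (x :* d) :+ x :* m :* e) ≈-refl
      x (I₂ b c) (δ m y z) (m b c) (I y z))
    (+-congʳ (*-congˡ (δ-scale x m y z)))

  -- Isolates the two mixed terms `n ⊗ δ m` and `m ⊗ δ n`: exchanging `m` and `n` exchanges them, so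
  -- they drop out of a commutator.
  δ-product : ∀ {D} m n → δ {suc D} m · δ n ≋ I₂ ⊗ (δ m · δ n) ⊞ n ⊗ δ m ⊞ (m ⊗ δ n ⊞ (m ∙ n) ⊗ I)
  δ-product {D} m n = begin
    (I₂ ⊗ δ m ⊞ m ⊗ I) · N
      ≈⟨ ·-distribʳ-⊞ N (I₂ ⊗ δ m) (m ⊗ I) ⟩
    (I₂ ⊗ δ m) · N ⊞ (m ⊗ I) · N
      ≈⟨ ⊞-cong (·-distribˡ-⊞ (I₂ ⊗ δ m) (I₂ ⊗ δ n) (n ⊗ I))
                (·-distribˡ-⊞ (m ⊗ I) (I₂ ⊗ δ n) (n ⊗ I)) ⟩
    ((I₂ ⊗ δ m) · (I₂ ⊗ δ n) ⊞ (I₂ ⊗ δ m) · (n ⊗ I)) ⊞ ((m ⊗ I) · (I₂ ⊗ δ n) ⊞ (m ⊗ I) · (n ⊗ I))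
      ≈⟨ ⊞-cong
           (⊞-cong (mix I₂ I₂ (∙-identityˡ I₂) (≋.refl {x = δ m · δ n}))
                   (mix I₂ n (∙-identityˡ n) (·-identityʳ (δ m))))
           (⊞-cong (mix m I₂ (∙-identityʳ m) (·-identityˡ (δ n)))
                   (mix m n (λ _ _ → ≈-refl) (·-identityʳ I))) ⟩
    I₂ ⊗ (δ m · δ n) ⊞ n ⊗ δ m ⊞ (m ⊗ δ n ⊞ (m ∙ n) ⊗ I) ∎
    where
    open ≋-Reasoning
    N = I₂ ⊗ δ {D} n ⊞ n ⊗ I
    mix : ∀ k l {o} {M N O : Mat D} → k ∙ l ≋₂ o → M · N ≋ O → (k ⊗ M) · (l ⊗ N) ≋ o ⊗ O
    mix k l {M = M} {N} kl MN = ≋.trans (⊗-mixed-product k l M N) (⊗-cong kl MN)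

  opaque
    unfolding _+₂_

    -- δ preserves commutators, written without subtraction so that it is a
    -- semiring identity.
    δ-commutator : ∀ {m n k} → m ∙ n ≋₂ n ∙ m +₂ k →
                   ∀ D → δ {D} m · δ n ≋ δ n · δ m ⊞ δ k
    δ-commutator eq zero [] [] = sym (+-identityʳ (0# * 0#))
    δ-commutator {m} {n} {k} eq (suc D) (b ∷ y) (c ∷ z) = trans (δ-product m n (b ∷ y) (c ∷ z))
      (trans
        (+-cong (+-congʳ (*-congˡ (δ-commutator eq D y z))) (+-congˡ (*-congʳ (eq b c))))
        (trans
          (solve 8 (λ i e nm δk x y p q →
              i :* (nm :+ δk) :+ x :+ (y :+ (p :+ q) :* e) :=
              (i :* nm :+ y :+ (x :+ p :* e)) :+ (i :* δk :+ q :* e)) ≈-refl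
            (I₂ b c) (I y z) ((δ n · δ m) y z) (δ k y z) (n b c * δ m y z) (m b c * δ n y z)
            ((n ∙ m) b c) (k b c))
          (+-congʳ (sym (δ-product n m (b ∷ y) (c ∷ z))))))

  -- The three cube matrices as values of `δ`.

  swap : Mat₂
  swap b c = 𝟙 (¬? (b Fin.≟ c))

  -- Equal heads leave the difference to the tails; distinct heads force equal tails. The decision
  -- is an argument so that matching on it evaluates both indicators.
  A-∷ : ∀ {D b c} (b≟c : Dec (b ≡ c)) (y z : X D) →
        A (suc D) (b ∷ y) (c ∷ z) ≈ 𝟙 b≟c * A D y z + 𝟙 (¬? b≟c) * I y z
  A-∷ {D} {b} (yes refl) y z = trans
    (𝟙-⇔ (Adjacent-∷-≡ b) (adjacent? (b ∷ y) (b ∷ z)) (adjacent? y z))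
    (solve 2 (λ d i → d := con 1 :* d :+ con 0 :* i) ≈-refl (A D y z) (I y z))
  A-∷ {D} {b} {c} (no b≢c) y z = trans
    (𝟙-⇔ (Adjacent-∷-≢ b≢c) (adjacent? (b ∷ y) (c ∷ z)) (y ≟ z))
    (solve 2 (λ d i → i := con 0 :* d :+ con 1 :* i) ≈-refl (A D y z) (I y z))

  A≋δ : ∀ D → A D ≋ δ swap
  A≋δ zero    []      []      = ≈-refl
  A≋δ (suc D) (b ∷ y) (c ∷ z) =
    trans (A-∷ (b Fin.≟ c) y z) (+-congʳ (*-congˡ (A≋δ D y z)))

  sign : Fin 2 → Carrier
  sign 0F = 1#
  sign 1F = - 1#

  opaque
    signs : Mat₂
    signs b c = sign b * I₂ b c

  -- The diagonal entry of `A*` with the weight in place of the distance, which makes it computable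
  -- by recursion on the vertex.
  θ : ∀ {D} → X D → Carrier
  θ {D} y = D ×# 1# - (2 ℕ.* weight y) ×# 1#

  -- A new coordinate adds 1 to the dimension; if it is a one, it also adds 2 to twice the weight,
  -- for a net change of -1.
  θ-∷ : ∀ {D} b (y : X D) → θ (b ∷ y) ≈ sign b + θ y
  θ-∷ {D} 0F y = +-assoc 1# (D ×# 1#) (- ((2 ℕ.* weight y) ×# 1#))
  θ-∷ {D} 1F y = trans
    (+-congˡ (-‿cong (reflexive (≡.cong (_×# 1#) (ℕ.*-suc 2 (weight y))))))
    (trans
      (+-congˡ (trans (sym (-‿+-comm 1# (1# + w))) (+-congˡ (sym (-‿+-comm 1# w)))))
      (trans
        -- The semiring solver treats `- 1#` as an atom `n`; the isolated `1 + n` is cancelled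
        -- afterwards.
        (solve 3 (λ d n v → con 1 :+ d :+ (n :+ (n :+ v)) := (con 1 :+ n) :+ (n :+ (d :+ v))) ≈-refl
          (D ×# 1#) (- 1#) (- w))
        (trans (+-congʳ (-‿inverseʳ 1#)) (+-identityˡ _))))
    where w = (2 ℕ.* weight y) ×# 1#

  diagonal-I : ∀ {D} (f : X D → Carrier) y z → diagonal f y z ≈ f y * I y z
  diagonal-I f y z with ⌊ y ≟ z ⌋
  ... | true  = sym (*-identityʳ (f y))
  ... | false = sym (zeroʳ (f y))

  opaque
    unfolding signs

    -- `θ` is additive and `I` multiplicative over coordinates; expanding their product gives the
    -- recursion of `δ`.
    θ-I≋δ : ∀ D (y z : X D) → θ y * I y z ≈ δ signs y z
    θ-I≋δ zero    []      []      = trans (*-identityʳ _) (-‿inverseʳ 0#)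
    θ-I≋δ (suc D) (b ∷ y) (c ∷ z) = trans (*-cong (θ-∷ b y) (I-∷ (b ∷ y) (c ∷ z)))
      (trans
        (solve 4 (λ s t i e → (s :+ t) :* (i :* e) := i :* (t :* e) :+ s :* i :* e) ≈-refl
          (sign b) (θ y) (I₂ b c) (I y z))
        (+-congʳ (*-congˡ (θ-I≋δ D y z))))

  A*≋δ : ∀ D → A* D ≋ δ signs
  A*≋δ D y z = trans (diagonal-I (λ y → scale (∂ (x₀ D) y)) y z)
    (trans (*-congʳ (reflexive (≡.cong scale (∂-x₀ y)))) (θ-I≋δ D y z))
    where
    scale : ℕ → Carrier
    scale n = D ×# 1# - (2 ℕ.* n) ×# 1#

  opaque
    imaginary : Mat₂ → Mat₂
    imaginary k b c = ½ * (- 𝐢 * k b c)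

    -- The hypothesis makes `k` the commutator of `swap` and `signs`, so `A D · A* D ⊖ A* D · A D`
    -- is `δ k`; the scalars then move inside by linearity.
    Aᵋ≋δ : ∀ {k} → swap ∙ signs ≋₂ signs ∙ swap +₂ k →
           ∀ D → Aᵋ D ≋ δ (imaginary k)
    Aᵋ≋δ {k} eq D y z = trans (*-congˡ (trans (*-congˡ commutator) (δ-scale (- 𝐢) k y z)))
      (δ-scale ½ (λ b c → - 𝐢 * k b c) y z)
      where
      commutator : (A D · A* D ⊖ A* D · A D) y z ≈ δ k y z
      commutator = trans
        (+-cong
          (trans (·-cong (A≋δ D) (A*≋δ D) y z)
            (trans (δ-commutator eq D y z) (+-comm _ _)))
          (-‿cong (·-cong (A*≋δ D) (A≋δ D) y z)))
        (trans (+-assoc _ _ _) (trans (+-congˡ (-‿inverseʳ _)) (+-identityʳ _)))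

  -- Reduction to dimension one.

  conjugate-by-P : ∀ {D} P₁⁻¹ m m′ {M M′ : Mat D} → P₁ ∙ P₁⁻¹ ≋₂ I₂ → P₁ ∙ m ∙ P₁⁻¹ ≋₂ m′ →
                   M ≋ δ m → M′ ≋ δ m′ → M′ ≋ P D · M · power P₁⁻¹ D
  conjugate-by-P {D} P₁⁻¹ m m′ {M} {M′} inv eq M≋ M′≋ = begin
    M′                          ≈⟨ M′≋ ⟩
    -- `P D` is `power P₁ D` by definition.
    δ m′                        ≈⟨ δ-conjugate P₁ P₁⁻¹ m m′ inv eq D ⟨
    P D · δ m · power P₁⁻¹ D    ≈⟨ ·-cong (·-cong (≋.refl {x = P D}) M≋) (≋.refl {x = power P₁⁻¹ D}) ⟨
    P D · M · power P₁⁻¹ D      ∎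
    where open ≋-Reasoning

  -- Agda keeps the names of an instantiated module in types but unfolds them
  -- in terms. With the matrices as indices, the conclusion of relations is
  -- read off the type of cube below and so meets the type of the theorem
  -- syntactically, without a conversion check over ℂ.
  data IsCube (D : ℕ) : Rel (Mat D) ℓ → Op₂ (Mat D) → (I A A* Aᵋ P : Mat D) → Set (c ⊔ ℓ) where
    isCube : IsCube D _≋_ _·_ I (A D) (A* D) (Aᵋ D) (P D)

  -- The ring and its elements `𝐢` and `½` are arbitrary here: what the argument uses of them is
  -- contained in the six identities of two-by-two matrices.
  relations : ∀ P₁⁻¹ k → P₁⁻¹ ∙ P₁ ≋₂ I₂ → P₁ ∙ P₁⁻¹ ≋₂ I₂ →
    swap ∙ signs ≋₂ signs ∙ swap +₂ k → P₁ ∙ swap ∙ P₁⁻¹ ≋₂ signs →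
    P₁ ∙ signs ∙ P₁⁻¹ ≋₂ imaginary k → P₁ ∙ imaginary k ∙ P₁⁻¹ ≋₂ swap →
    ∀ {D _≋′_ _·′_ I′ A′ A*′ Aᵋ′ P′} → IsCube D _≋′_ _·′_ I′ A′ A*′ Aᵋ′ P′ →
    Σ[ P-invertible ∈ Invertible _≋′_ I′ _·′_ P′ ]
      let P⁻¹ = proj₁ P-invertible in
        (A*′ ≋′ ((P′ ·′ A′) ·′ P⁻¹)) ×
        (Aᵋ′ ≋′ ((P′ ·′ A*′) ·′ P⁻¹)) ×
        (A′ ≋′ ((P′ ·′ Aᵋ′) ·′ P⁻¹))
  relations P₁⁻¹ k invˡ invʳ comm P-swap P-signs P-ε {D} isCube =
      (power P₁⁻¹ D , power-inverse P₁⁻¹ P₁ invˡ D , power-inverse P₁ P₁⁻¹ invʳ D)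
    , conjugate-by-P P₁⁻¹ swap signs invʳ P-swap (A≋δ D) (A*≋δ D)
    , conjugate-by-P P₁⁻¹ signs (imaginary k) invʳ P-signs (A*≋δ D) (Aᵋ≋δ comm D)
    , conjugate-by-P P₁⁻¹ (imaginary k) swap invʳ P-ε (Aᵋ≋δ comm D) (A≋δ D)

-- Opened in full only here, since the names clash with those of CubeMatrices R 𝐢 ½ above.
open import Defs

-- The two-by-two identities over the complex numbers.

open TensorPower ℂ-commutativeRing 𝐢 ½ℂ
open CommutativeRing ℂ-commutativeRing using (_*_; -_; 0#; 1#; _+_)

-- Half the conjugate transpose of `P₁`, whose rows are orthogonal of squared norm 2.
P₁⁻¹ : Mat₂
P₁⁻¹ _  0F = ½ℂ
P₁⁻¹ 0F 1F = ½ℂ * 𝐢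
P₁⁻¹ 1F 1F = ½ℂ * (- 𝐢)

[swap,signs] : Mat₂
[swap,signs] 0F 1F = - (1# + 1#)
[swap,signs] 1F 0F = 1# + 1#
[swap,signs] _  _  = 0#

entry : Mat₂ → ℕ → Fin 2 → Fin 2 → ℚ × ℚ
entry m i b c = Real.seq (proj₁ (m b c)) i , Real.seq (proj₂ (m b c)) i

-- A vector rather than a function, so that matrices with constant entries
-- are compared by a single refl.
entries : Mat₂ → ℕ → Vec (Vec (ℚ × ℚ) 2) 2
entries m i = tabulate (tabulate ∘ entry m i)

lookup-entries : ∀ m i b c → lookup (lookup (entries m i) b) c ≡ entry m i b c
lookup-entries m i b c = ≡.trans
  (≡.cong (λ row → lookup row c) (lookup∘tabulate (tabulate ∘ entry m i) b))
  (lookup∘tabulate (entry m i b) c)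

-- Termwise equal Cauchy sequences represent equal reals, so no moduli of convergence need be
-- compared and rational arithmetic suffices.
entries≗⇒≋₂ : ∀ m n → entries m ≗ entries n → m ≋₂ n
entries≗⇒≋₂ m n eq b c = Real.≗⇒≈ (≡.cong proj₁ ∘ entry≗) , Real.≗⇒≈ (≡.cong proj₂ ∘ entry≗)
  where
  entry≗ : ∀ i → entry m i b c ≡ entry n i b c
  entry≗ i = ≡.trans (≡.sym (lookup-entries m i b c))
    (≡.trans (≡.cong (λ rows → lookup (lookup rows b) c) (eq i)) (lookup-entries n i b c))

opaque
  unfolding _∙_ _+₂_ signs imaginary

  P₁⁻¹∙P₁≋I₂ : P₁⁻¹ ∙ P₁ ≋₂ I₂
  P₁⁻¹∙P₁≋I₂ = entries≗⇒≋₂ _ _ λ _ → refl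

  P₁∙P₁⁻¹≋I₂ : P₁ ∙ P₁⁻¹ ≋₂ I₂
  P₁∙P₁⁻¹≋I₂ = entries≗⇒≋₂ _ _ λ _ → refl

  swap-signs-commutator : swap ∙ signs ≋₂ signs ∙ swap +₂ [swap,signs]
  swap-signs-commutator = entries≗⇒≋₂ _ _ λ _ → refl

  P₁-conjugates-swap : P₁ ∙ swap ∙ P₁⁻¹ ≋₂ signs
  P₁-conjugates-swap = entries≗⇒≋₂ _ _ λ _ → refl

  P₁-conjugates-signs : P₁ ∙ signs ∙ P₁⁻¹ ≋₂ imaginary [swap,signs]
  P₁-conjugates-signs = entries≗⇒≋₂ _ _ λ _ → refl

  P₁-conjugates-imaginary : P₁ ∙ imaginary [swap,signs] ∙ P₁⁻¹ ≋₂ swap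
  P₁-conjugates-imaginary = entries≗⇒≋₂ _ _ λ _ → refl

cube : ∀ D → IsCube D _≋_ _·_ I (A D) (A* D) (Aᵋ D) (P D)
cube D = isCube

theorem7p4 : (D : ℕ) → .{{_ : NonZero D}} →
    Σ[ P-invertible ∈ Invertible _≋_ I _·_ (P D) ]
    let P⁻¹ = proj₁ P-invertible in
    (A* D ≋ P D · A D · P⁻¹) ×
    (Aᵋ D ≋ P D · A* D · P⁻¹) ×
    (A D ≋ P D · Aᵋ D · P⁻¹)
theorem7p4 D = relations P₁⁻¹ [swap,signs] P₁⁻¹∙P₁≋I₂ P₁∙P₁⁻¹≋I₂ swap-signs-commutator
  P₁-conjugates-swap P₁-conjugates-signs P₁-conjugates-imaginary (cube D)
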